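{- Let $G$ be a graph that contains an induced $(n,m)$-necklace, with $n\geq 5$ and $m\geq 1$, whose cycle has good neighbors in $G$. Then either $KB_e^2(G)$ or $KB_e^3(G)$ contains an induced $(n,m')$-necklace whose cycle has good neighbors, with $m'>m$.
   Context: All graphs are finite, simple and undirected. A biclique of a graph $G$ is a maximal induced complete bipartite subgraph of $G$. The edge-biclique graph $KB_e(G)$ has one vertex for each biclique of $G$, two vertices being adjacent when the corresponding bicliques share at least one edge; $KB_e^0(G)=G$, $KB_e^k(G)=KB_e(KB_e^{k-1}(G))$. For $n\ge 3$, $m\ge 1$, the $(n,m)$-necklace is the graph on $n+m$ vertices consisting of an induced cycle $C_n$ and a complete graph $K_m$ such that, for one fixed edge $e$ of $C_n$, every vertex of $K_m$ is adjacent to both endpoints of $e$ and to no other vertex of $C_n$. An induced cycle $C=v_0\ldots v_{n-1}$ ($n\ge 5$) of a graph $H$ has good neighbors if for every vertex $v\in V(H)\setminus V(C)$ and every $i$ (indices mod $n$), if $v$ is adjacent to both $v_{i-1}$ and $v_{i+1}$ then $v$ is adjacent to $v_i$. -}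

module Defs where

open import Data.Nat using (ℕ; zero; suc; _+_; _<_; _≥_)
open import Data.Nat.DivMod using (_mod_)
open import Data.Fin using (Fin; toℕ; _≟_)
open import Data.Bool using (Bool; true; false; _∧_; _∨_; not; if_then_else_)
open import Data.Bool.ListAction using (all; any)
open import Data.List using (List; []; _∷_; _++_; map; filterᵇ; length; lookup; allFin)
open import Data.Vec using (Vec) renaming ([] to []ᵥ; _∷_ to _∷ᵥ_; lookup to lookupᵥ)
open import Data.Product using (_×_; Σ; ∃-syntax)
open import Data.Sum using (_⊎_)
open import Relation.Nullary using (¬_; does)
open import Relation.Binary.PropositionalEquality using (_≡_)

record Graph : Set where
  field
    size : ℕ
    adj  : Fin size → Fin size → Bool
open Graph public

Adj : (G : Graph) → Fin (size G) → Fin (size G) → Set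
Adj G u v = adj G u v ≡ true

IsSimple : Graph → Set
IsSimple G = (∀ u v → adj G u v ≡ adj G v u) × (∀ u → adj G u u ≡ false)

Subset : ℕ → Set
Subset n = Vec Bool n

allSubsets : (n : ℕ) → List (Subset n)
allSubsets zero    = []ᵥ ∷ []
allSubsets (suc n) = map (true ∷ᵥ_) (allSubsets n) ++ map (false ∷ᵥ_) (allSubsets n)

_∈ˢ_ : ∀ {n} → Fin n → Subset n → Bool
i ∈ˢ S = lookupᵥ S i

forallV : (n : ℕ) → (Fin n → Bool) → Bool
forallV n p = all p (allFin n)

existsV : (n : ℕ) → (Fin n → Bool) → Bool
existsV n p = any p (allFin n)

_⇒ᵇ_ : Bool → Bool → Bool
a ⇒ᵇ b = not a ∨ b

_⇔ᵇ_ : Bool → Bool → Bool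
a ⇔ᵇ b = (a ⇒ᵇ b) ∧ (b ⇒ᵇ a)

_≠ᵇ_ : ∀ {n} → Fin n → Fin n → Bool
u ≠ᵇ v = not (does (u ≟ v))

_⊆ᵇ_ : ∀ {n} → Subset n → Subset n → Bool
_⊆ᵇ_ {n} S T = forallV n (λ i → (i ∈ˢ S) ⇒ᵇ (i ∈ˢ T))

_⊂ᵇ_ : ∀ {n} → Subset n → Subset n → Bool
_⊂ᵇ_ {n} S T = (S ⊆ᵇ T) ∧ existsV n (λ i → (i ∈ˢ T) ∧ not (i ∈ˢ S))

IsCompleteBipartiteᵇ : (G : Graph) → Subset (size G) → Bool
IsCompleteBipartiteᵇ G S = any ok (allSubsets n)
  where
  n = size G
  ok : Subset n → Bool
  ok A = (A ⊆ᵇ S)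
       ∧ existsV n (λ u → u ∈ˢ A)
       ∧ existsV n (λ u → (u ∈ˢ S) ∧ not (u ∈ˢ A))
       ∧ forallV n (λ u → forallV n (λ v →
           ((u ∈ˢ S) ∧ (v ∈ˢ S) ∧ (u ≠ᵇ v)) ⇒ᵇ
             (adj G u v ⇔ᵇ not ((u ∈ˢ A) ⇔ᵇ (v ∈ˢ A)))))

IsBicliqueᵇ : (G : Graph) → Subset (size G) → Bool
IsBicliqueᵇ G S = IsCompleteBipartiteᵇ G S
  ∧ all (λ T → not ((S ⊂ᵇ T) ∧ IsCompleteBipartiteᵇ G T)) (allSubsets (size G))

bicliques : (G : Graph) → List (Subset (size G))
bicliques G = filterᵇ (IsBicliqueᵇ G) (allSubsets (size G))

shareEdgeᵇ : (G : Graph) → Subset (size G) → Subset (size G) → Bool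
shareEdgeᵇ G S T = existsV (size G) (λ u → existsV (size G) (λ v →
  (u ∈ˢ S) ∧ (u ∈ˢ T) ∧ (v ∈ˢ S) ∧ (v ∈ˢ T) ∧ adj G u v))

KBe : Graph → Graph
KBe G = record
  { size = length (bicliques G)
  ; adj  = λ i j → (i ≠ᵇ j) ∧ shareEdgeᵇ G (lookup (bicliques G) i) (lookup (bicliques G) j)
  }

KBe^ : ℕ → Graph → Graph
KBe^ zero    G = G
KBe^ (suc k) G = KBe (KBe^ k G)

sucMod : ∀ {n} → Fin n → Fin n
sucMod {suc k} i = suc (toℕ i) mod suc k

predMod : ∀ {n} → Fin n → Fin n
predMod {suc k} i = (toℕ i + k) mod suc k

CycAdj : ∀ {n} → Fin n → Fin n → Set
CycAdj i j = (j ≡ sucMod i) ⊎ (i ≡ sucMod j)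

record InducedNecklace (G : Graph) (n m : ℕ) : Set where
  field
    cyc : Fin n → Fin (size G)
    cl  : Fin m → Fin (size G)
    e   : Fin n
    cyc-inj    : ∀ i j → cyc i ≡ cyc j → i ≡ j
    cl-inj     : ∀ a b → cl a ≡ cl b → a ≡ b
    cyc≢cl     : ∀ i a → ¬ (cyc i ≡ cl a)
    cyc-adj    : ∀ i j → Adj G (cyc i) (cyc j) → CycAdj i j
    cyc-adj⁻   : ∀ i j → CycAdj i j → Adj G (cyc i) (cyc j)
    cl-adj     : ∀ a b → ¬ (a ≡ b) → Adj G (cl a) (cl b)
    cl-cyc     : ∀ a i → Adj G (cl a) (cyc i) → (i ≡ e) ⊎ (i ≡ sucMod e)
    cl-cyc⁻    : ∀ a i → (i ≡ e) ⊎ (i ≡ sucMod e) → Adj G (cl a) (cyc i)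
open InducedNecklace public

GoodNeighbors : (G : Graph) {n : ℕ} → (Fin n → Fin (size G)) → Set
GoodNeighbors G {n} c = ∀ (v : Fin (size G)) → (∀ i → ¬ (v ≡ c i)) →
  ∀ (i : Fin n) → Adj G v (c (predMod i)) → Adj G v (c (sucMod i)) → Adj G v (c i)

HasGoodNecklace : Graph → ℕ → ℕ → Set
HasGoodNecklace G n m = Σ (InducedNecklace G n m) (λ N → GoodNeighbors G (cyc N))

{-# OPTIONS --safe #-}
module Submission where

-- In a graph with good neighbors, a biclique containing c(i-1), c(i), c(i+1) is a star centred
-- at c(i); hence the bicliques B(i) extending these paths again form an induced cycle with good
-- neighbors.  A vertex w whose neighbors on the cycle are c(i), c(i+1) yields bicliques
-- {c(i-1), c(i), w, …} and {w, c(i+1), c(i+2), …}; these meet, among the B(j), exactly the pair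
-- B(i-1), B(i) and the pair B(i+1), B(i+2).  So one application of KBe produces cliques of m such
-- vertices on both sides of the original edge.  Applying KBe again to the clique on the left side,
-- the bicliques on its left are not adjacent to those on its right: a common edge would give a
-- biclique of the original graph meeting the stars B(i), B(i+3) and the clique member between
-- them, contradicting good neighbors.  A third application sends both families to the same edge
-- of the cycle, where they form a single clique; one left member and the m right ones are enough.

open import Defs
open import Data.Nat using (ℕ; zero; suc; _+_; _*_; _<_; _≥_; s≤s; z≤n)
open import Data.Nat.Properties using (+-comm; +-suc; +-cancelˡ-≡; <-≤-trans; ≤-refl; <⇒≱)
open import Data.Nat.DivMod
  using (_%_; _/_; m%n<n; m%n%n≡m%n; %-distribˡ-+; [m+n]%n≡m%n; m<n⇒m%n≡m; m≡m%n+[m/n]*n)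
open import Data.Nat.Divisibility using (divides; ∣⇒≤)
open import Data.Fin using (Fin; zero; suc; toℕ; _≟_)
open import Data.Fin.Properties using (toℕ-fromℕ<; toℕ-injective; toℕ<n; any?)
open import Data.Fin.Subset using (⁅_⁆; _∪_; _⊃_; _⊆_)
open import Data.Fin.Subset.Properties using (x∈⁅x⁆; x∈⁅y⁆⇒x≡y; x∈p∪q⁺; x∈p∪q⁻; ⊆-refl; ⊆-trans)
open import Data.Fin.Subset.Induction using (⊃-wellFounded; Acc; acc)
open import Data.Bool using (Bool; true; false; _∧_; not; _xor_; T)
open import Data.Bool.ListAction using (all; any)
open import Data.Bool.Properties using (T-≡; ¬-not)
open import Data.List using (List; []; _∷_; allFin) renaming (lookup to lookupₗ)
open import Data.List.Membership.Propositional using (find; lose) renaming (_∈_ to _∈ₗ_)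
open import Data.List.Membership.Propositional.Properties
  using (∈-allFin; ∈-map⁺; ∈-++⁺ˡ; ∈-++⁺ʳ; ∈-filter⁺; ∈-filter⁻; ∈-lookup)
open import Data.List.Relation.Unary.All as All using (All)
open import Data.List.Relation.Unary.All.Properties using (all⁺; all⁻)
open import Data.List.Relation.Unary.Any as Any using (Any)
open import Data.List.Relation.Unary.Any.Properties using (any⁺; any⁻; lookup-index)
open import Data.Vec using (_[_]=_) renaming ([] to []ᵥ; _∷_ to _∷ᵥ_)
open import Data.Vec.Properties using (lookup⇒[]=; []=⇒lookup)
open import Data.Product using (∃; _×_; _,_; proj₁; proj₂; ∃-syntax)
open import Data.Sum using (_⊎_; inj₁; inj₂)
open import Data.Empty using (⊥; ⊥-elim)
open import Function using (_∘_; case_of_)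
open import Function.Bundles using (Equivalence)
open import Relation.Nullary using (¬_; yes; no; contradiction)
open import Relation.Nullary.Decidable using (dec-false; T?)
open import Relation.Binary.PropositionalEquality
  using (_≡_; _≢_; refl; sym; trans; cong; subst; module ≡-Reasoning)

-- Boolean tests as propositions

to-T : ∀ {b} → b ≡ true → T b
to-T = Equivalence.from T-≡

from-T : ∀ {b} → T b → b ≡ true
from-T = Equivalence.to T-≡

∧-intro : ∀ {a b} → a ≡ true → b ≡ true → a ∧ b ≡ true
∧-intro refl refl = refl

∧-elim : ∀ {a b} → a ∧ b ≡ true → a ≡ true × b ≡ true
∧-elim {true} {true} refl = refl , refl

⇒ᵇ-intro : ∀ {a b} → (a ≡ true → b ≡ true) → (a ⇒ᵇ b) ≡ true
⇒ᵇ-intro {true}  f = f refl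
⇒ᵇ-intro {false} f = refl

⇒ᵇ-elim : ∀ {a b} → (a ⇒ᵇ b) ≡ true → a ≡ true → b ≡ true
⇒ᵇ-elim p refl = p

⇔ᵇ-not⇒xor : ∀ a b c → (a ⇔ᵇ not (b ⇔ᵇ c)) ≡ true → a ≡ b xor c
⇔ᵇ-not⇒xor true  true  false _ = refl
⇔ᵇ-not⇒xor true  false true  _ = refl
⇔ᵇ-not⇒xor false true  true  _ = refl
⇔ᵇ-not⇒xor false false false _ = refl

xor⇒⇔ᵇ-not : ∀ a b c → a ≡ b xor c → (a ⇔ᵇ not (b ⇔ᵇ c)) ≡ true
xor⇒⇔ᵇ-not _ true  true  refl = refl
xor⇒⇔ᵇ-not _ true  false refl = refl
xor⇒⇔ᵇ-not _ false true  refl = refl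
xor⇒⇔ᵇ-not _ false false refl = refl

-- Of two different Boolean values, a third differs from exactly one. Read with sides of a
-- bipartition as values, this becomes `split`.
xor-split : ∀ a b c → a xor b ≡ true →
  (a xor c ≡ true × ¬ (b xor c ≡ true)) ⊎ (¬ (a xor c ≡ true) × b xor c ≡ true)
xor-split true  false true  _ = inj₂ ((λ ()) , refl)
xor-split true  false false _ = inj₁ (refl , λ ())
xor-split false true  true  _ = inj₁ (refl , λ ())
xor-split false true  false _ = inj₂ ((λ ()) , refl)

true-iff⇒≡ : ∀ {a b} → (a ≡ true → b ≡ true) → (b ≡ true → a ≡ true) → a ≡ b
true-iff⇒≡ {true}  {_}     f g = sym (f refl)
true-iff⇒≡ {false} {true}  f g = g refl
true-iff⇒≡ {false} {false} f g = refl

all-false : ∀ {A : Set} (p : A → Bool) xs → all p xs ≡ false → ∃ λ x → p x ≡ false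
all-false p (x ∷ xs) eq with p x in px
... | false = x , px
... | true  = all-false p xs eq

any-elim : ∀ {A : Set} (p : A → Bool) xs → any p xs ≡ true → ∃ λ x → p x ≡ true
any-elim p xs h with find (any⁻ p xs (to-T h))
... | x , _ , px = x , from-T px

any-intro : ∀ {A : Set} (p : A → Bool) xs {x} → x ∈ₗ xs → p x ≡ true → any p xs ≡ true
any-intro p xs x∈xs px = from-T (any⁺ p (lose x∈xs (to-T px)))

existsV-intro : ∀ {n} (p : Fin n → Bool) i → p i ≡ true → existsV n p ≡ true
existsV-intro p i = any-intro p (allFin _) (∈-allFin i)

forallV-elim : ∀ {n} (p : Fin n → Bool) → forallV n p ≡ true → ∀ i → p i ≡ true
forallV-elim p h i = from-T (All.lookup (all⁺ p (allFin _) (to-T h)) (∈-allFin i))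

forallV-intro : ∀ {n} (p : Fin n → Bool) → (∀ i → p i ≡ true) → forallV n p ≡ true
forallV-intro p h = from-T (all⁻ p (All.universal (to-T ∘ h) (allFin _)))

∈-allSubsets : ∀ {n} (S : Subset n) → S ∈ₗ allSubsets n
∈-allSubsets []ᵥ          = Any.here refl
∈-allSubsets (true ∷ᵥ S)  = ∈-++⁺ˡ (∈-map⁺ (true ∷ᵥ_) (∈-allSubsets S))
∈-allSubsets (false ∷ᵥ S) = ∈-++⁺ʳ _ (∈-map⁺ (false ∷ᵥ_) (∈-allSubsets S))

⊆ᵇ⇒⊆ : ∀ {n} (S T : Subset n) → (S ⊆ᵇ T) ≡ true → S ⊆ T
⊆ᵇ⇒⊆ S T h {x} x∈S =
  lookup⇒[]= x T (⇒ᵇ-elim (forallV-elim _ h x) ([]=⇒lookup x∈S))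

⊂ᵇ⇒⊃ : ∀ {n} (S T : Subset n) → (S ⊂ᵇ T) ≡ true → T ⊃ S
⊂ᵇ⇒⊃ S T h with ∧-elim h
... | S⊆T , S≢T with any-elim _ (allFin _) S≢T
... | x , hx with ∧-elim hx
... | x∈T , x∉S = ⊆ᵇ⇒⊆ S T S⊆T , x , lookup⇒[]= x T x∈T ,
  λ x∈S → case trans (sym x∉S) (cong not ([]=⇒lookup x∈S)) of λ ()

≠ᵇ-intro : ∀ {n} {i j : Fin n} → i ≢ j → (i ≠ᵇ j) ≡ true
≠ᵇ-intro {i = i} {j} i≢j = cong not (dec-false (i ≟ j) i≢j)

≠ᵇ-elim : ∀ {n} {i j : Fin n} → (i ≠ᵇ j) ≡ true → i ≢ j
≠ᵇ-elim {i = i} {j} h i≡j with i ≟ j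
... | no i≢j = i≢j i≡j

-- Bicliques as vertices of the edge-biclique graph

module Bicliques (G : Graph) (simple : IsSimple G) where

  V : Set
  V = Fin (size G)

  KV : Set
  KV = Fin (size (KBe G))

  symm : ∀ {u v} → Adj G u v → Adj G v u
  symm {u} {v} = trans (sym (proj₁ simple u v))

  irr : ∀ {u} → ¬ Adj G u u
  irr {u} h = case trans (sym h) (proj₂ simple u) of λ ()

  subset : KV → Subset (size G)
  subset = lookupₗ (bicliques G)

  infix 4 _∈_
  record _∈_ (u : V) (X : KV) : Set where
    constructor mem
    field holds : (u ∈ˢ subset X) ≡ true
  open _∈_

  -- `crosses` and `isSide` restate the test local to `IsCompleteBipartiteᵇ`, which cannot be named
  -- from outside.
  crosses : Subset (size G) → Subset (size G) → V → V → Bool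
  crosses S A u v = ((u ∈ˢ S) ∧ (v ∈ˢ S) ∧ (u ≠ᵇ v)) ⇒ᵇ
    (adj G u v ⇔ᵇ not ((u ∈ˢ A) ⇔ᵇ (v ∈ˢ A)))

  isSide : Subset (size G) → Subset (size G) → Bool
  isSide S A = (A ⊆ᵇ S)
    ∧ existsV (size G) (λ u → u ∈ˢ A)
    ∧ existsV (size G) (λ u → (u ∈ˢ S) ∧ not (u ∈ˢ A))
    ∧ forallV (size G) (λ u → forallV (size G) (crosses S A u))

  completeBipartite-sides : ∀ S → IsCompleteBipartiteᵇ G S ≡ true → ∃ λ A →
    ∀ {u v} → (u ∈ˢ S) ≡ true → (v ∈ˢ S) ≡ true → adj G u v ≡ (u ∈ˢ A) xor (v ∈ˢ A)
  completeBipartite-sides S h with any-elim (isSide S) (allSubsets (size G)) h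
  ... | A , A-side with ∧-elim {A ⊆ᵇ S} A-side
  ... | _ , h₂ with ∧-elim {existsV (size G) (λ u → u ∈ˢ A)} h₂
  ... | _ , h₃ with ∧-elim {existsV (size G) (λ u → (u ∈ˢ S) ∧ not (u ∈ˢ A))} h₃
  ... | _ , h₄ = A , sides
    where
    sides : ∀ {u v} → (u ∈ˢ S) ≡ true → (v ∈ˢ S) ≡ true → adj G u v ≡ (u ∈ˢ A) xor (v ∈ˢ A)
    sides {u} {v} u∈S v∈S with u ≟ v
    ... | no u≢v = ⇔ᵇ-not⇒xor (adj G u v) (u ∈ˢ A) (v ∈ˢ A)
            (⇒ᵇ-elim (forallV-elim (crosses S A u)
                        (forallV-elim (λ u → forallV (size G) (crosses S A u)) h₄ u) v)
                     (∧-intro u∈S (∧-intro v∈S (≠ᵇ-intro u≢v))))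
    -- On the diagonal both sides are false: there are no loops, and a bit never differs from
    -- itself.
    ... | yes refl with u ∈ˢ A
    ...   | true  = proj₂ simple u
    ...   | false = proj₂ simple u

  -- Either the maximality test succeeds, or it fails at a strictly larger complete bipartite `T`,
  -- from which the search continues. Finiteness bounds the ascent.
  completeBipartite-∈-biclique : ∀ S → Acc _⊃_ S → IsCompleteBipartiteᵇ G S ≡ true →
    ∃ λ T → S ⊆ T × IsBicliqueᵇ G T ≡ true
  completeBipartite-∈-biclique S (acc rs) h
    with all (λ T → not ((S ⊂ᵇ T) ∧ IsCompleteBipartiteᵇ G T)) (allSubsets (size G)) in eq
  ... | true  = S , ⊆-refl , ∧-intro h eq
  ... | false with all-false _ (allSubsets (size G)) eq
  ...   | T , hT with S ⊂ᵇ T in S⊂T | IsCompleteBipartiteᵇ G T in T-cb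
  ...     | true | true =
    let T′ , T⊆T′ , T′-bic = completeBipartite-∈-biclique T (rs (⊂ᵇ⇒⊃ S T S⊂T)) T-cb
    in T′ , ⊆-trans (proj₁ (⊂ᵇ⇒⊃ S T S⊂T)) T⊆T′ , T′-bic

  -- The two sides are the middle vertex `b` alone and the ends `a`, `c`.
  path-completeBipartite : ∀ {a b c} → Adj G a b → Adj G b c → ¬ Adj G a c →
    IsCompleteBipartiteᵇ G (⁅ a ⁆ ∪ ⁅ b ⁆ ∪ ⁅ c ⁆) ≡ true
  path-completeBipartite {a} {b} {c} ab bc ¬ac =
    any-intro (isSide P) (allSubsets (size G)) (∈-allSubsets ⁅ b ⁆)
      (∧-intro A⊆P (∧-intro A-nonempty (∧-intro P∖A-nonempty A-crosses)))
    where
    P : Subset (size G)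
    P = ⁅ a ⁆ ∪ ⁅ b ⁆ ∪ ⁅ c ⁆

    b∈A : (b ∈ˢ ⁅ b ⁆) ≡ true
    b∈A = []=⇒lookup (x∈⁅x⁆ b)

    ∉A : ∀ {x} → x ≢ b → (x ∈ˢ ⁅ b ⁆) ≡ false
    ∉A x≢b = ¬-not λ h → x≢b (x∈⁅y⁆⇒x≡y b (lookup⇒[]= _ _ h))

    a∉A : (a ∈ˢ ⁅ b ⁆) ≡ false
    a∉A = ∉A λ { refl → irr ab }

    c∉A : (c ∈ˢ ⁅ b ⁆) ≡ false
    c∉A = ∉A λ { refl → irr bc }

    member : ∀ {x} → (x ∈ˢ (⁅ a ⁆ ∪ ⁅ b ⁆ ∪ ⁅ c ⁆)) ≡ true → (x ≡ a ⊎ x ≡ c) ⊎ x ≡ b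
    member {x} h with x∈p∪q⁻ _ _ (lookup⇒[]= x _ h)
    ... | inj₁ x∈a = inj₁ (inj₁ (x∈⁅y⁆⇒x≡y a x∈a))
    ... | inj₂ h′ with x∈p∪q⁻ _ _ h′
    ...   | inj₁ x∈b = inj₂ (x∈⁅y⁆⇒x≡y b x∈b)
    ...   | inj₂ x∈c = inj₁ (inj₂ (x∈⁅y⁆⇒x≡y c x∈c))

    ends-∉A : ∀ {x} → x ≡ a ⊎ x ≡ c → (x ∈ˢ ⁅ b ⁆) ≡ false
    ends-∉A (inj₁ refl) = a∉A
    ends-∉A (inj₂ refl) = c∉A

    ends-adj : ∀ {x} → x ≡ a ⊎ x ≡ c → Adj G x b
    ends-adj (inj₁ refl) = ab
    ends-adj (inj₂ refl) = symm bc

    ends-nonadj : ∀ {x y} → x ≡ a ⊎ x ≡ c → y ≡ a ⊎ y ≡ c → adj G x y ≡ false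
    ends-nonadj (inj₁ refl) (inj₁ refl) = proj₂ simple a
    ends-nonadj (inj₁ refl) (inj₂ refl) = ¬-not ¬ac
    ends-nonadj (inj₂ refl) (inj₁ refl) = ¬-not (¬ac ∘ symm)
    ends-nonadj (inj₂ refl) (inj₂ refl) = proj₂ simple c

    sides : ∀ {u v} → (u ≡ a ⊎ u ≡ c) ⊎ u ≡ b → (v ≡ a ⊎ v ≡ c) ⊎ v ≡ b →
      adj G u v ≡ (u ∈ˢ ⁅ b ⁆) xor (v ∈ˢ ⁅ b ⁆)
    sides (inj₁ p) (inj₁ q) rewrite ends-∉A p | ends-∉A q = ends-nonadj p q
    sides (inj₁ p) (inj₂ refl) rewrite ends-∉A p | b∈A = ends-adj p
    sides (inj₂ refl) (inj₁ q) rewrite ends-∉A q | b∈A = symm (ends-adj q)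
    sides (inj₂ refl) (inj₂ refl) rewrite b∈A = proj₂ simple b

    A⊆P : (⁅ b ⁆ ⊆ᵇ P) ≡ true
    A⊆P = forallV-intro (λ i → (i ∈ˢ ⁅ b ⁆) ⇒ᵇ (i ∈ˢ P)) λ i →
      ⇒ᵇ-intro {i ∈ˢ ⁅ b ⁆} λ i∈ →
        []=⇒lookup {xs = P} (x∈p∪q⁺ (inj₂ (x∈p∪q⁺ (inj₁ (lookup⇒[]= i ⁅ b ⁆ i∈)))))

    A-nonempty : existsV (size G) (λ u → u ∈ˢ ⁅ b ⁆) ≡ true
    A-nonempty = existsV-intro (λ u → u ∈ˢ ⁅ b ⁆) b b∈A

    P∖A-nonempty : existsV (size G) (λ u → (u ∈ˢ P) ∧ not (u ∈ˢ ⁅ b ⁆)) ≡ true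
    P∖A-nonempty = existsV-intro (λ u → (u ∈ˢ P) ∧ not (u ∈ˢ ⁅ b ⁆)) a
      (∧-intro ([]=⇒lookup (x∈p∪q⁺ (inj₁ (x∈⁅x⁆ a)))) (cong not a∉A))

    A-crosses : forallV (size G) (λ u → forallV (size G) (crosses P ⁅ b ⁆ u)) ≡ true
    A-crosses = forallV-intro (λ u → forallV (size G) (crosses P ⁅ b ⁆ u)) λ u →
      forallV-intro (crosses P ⁅ b ⁆ u) λ v →
        ⇒ᵇ-intro {(u ∈ˢ P) ∧ (v ∈ˢ P) ∧ (u ≠ᵇ v)} λ h →
          let u∈P , h′ = ∧-elim {u ∈ˢ P} {(v ∈ˢ P) ∧ (u ≠ᵇ v)} h
              v∈P , _  = ∧-elim {v ∈ˢ P} {u ≠ᵇ v} h′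
          in xor⇒⇔ᵇ-not (adj G u v) (u ∈ˢ ⁅ b ⁆) (v ∈ˢ ⁅ b ⁆) (sides (member u∈P) (member v∈P))

  path-∈-biclique : ∀ {a b c} → Adj G a b → Adj G b c → ¬ Adj G a c →
    ∃ λ X → a ∈ X × b ∈ X × c ∈ X
  path-∈-biclique {a} {b} {c} ab bc ¬ac
    with completeBipartite-∈-biclique (⁅ a ⁆ ∪ ⁅ b ⁆ ∪ ⁅ c ⁆) (⊃-wellFounded _)
           (path-completeBipartite ab bc ¬ac)
  ... | T , S⊆T , T-bic = Any.index T∈ ,
      into (x∈p∪q⁺ (inj₁ (x∈⁅x⁆ a))) ,
      into (x∈p∪q⁺ (inj₂ (x∈p∪q⁺ (inj₁ (x∈⁅x⁆ b))))) ,
      into (x∈p∪q⁺ (inj₂ (x∈p∪q⁺ (inj₂ (x∈⁅x⁆ c)))))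
    where
    T∈ : T ∈ₗ bicliques G
    T∈ = ∈-filter⁺ (T? ∘ IsBicliqueᵇ G) (∈-allSubsets T) (to-T T-bic)

    into : ∀ {x} → (⁅ a ⁆ ∪ ⁅ b ⁆ ∪ ⁅ c ⁆) [ x ]= true → x ∈ Any.index T∈
    into {x} h = mem (trans (cong (x ∈ˢ_) (sym (lookup-index T∈))) ([]=⇒lookup (S⊆T h)))

  -- The ends of an edge lie on opposite sides, so `x` shares the side of exactly one of them and is
  -- adjacent to exactly the other.
  split-sides : ∀ {S} A →
    (∀ {u v} → (u ∈ˢ S) ≡ true → (v ∈ˢ S) ≡ true → adj G u v ≡ (u ∈ˢ A) xor (v ∈ˢ A)) →
    ∀ {u v x} → (u ∈ˢ S) ≡ true → (v ∈ˢ S) ≡ true → (x ∈ˢ S) ≡ true → Adj G u v →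
    (Adj G u x × ¬ Adj G v x) ⊎ (¬ Adj G u x × Adj G v x)
  split-sides A sides {u} {v} {x} u∈ v∈ x∈ uv
    with xor-split (u ∈ˢ A) (v ∈ˢ A) (x ∈ˢ A) (trans (sym (sides u∈ v∈)) uv)
  ... | inj₁ (ux , ¬vx) =
    inj₁ (trans (sides u∈ x∈) ux , λ vx → ¬vx (trans (sym (sides v∈ x∈)) vx))
  ... | inj₂ (¬ux , vx) =
    inj₂ ((λ ux → ¬ux (trans (sym (sides u∈ x∈)) ux)) , trans (sides v∈ x∈) vx)

  isBiclique : ∀ X → IsBicliqueᵇ G (subset X) ≡ true
  isBiclique X = from-T (proj₂ (∈-filter⁻ (T? ∘ IsBicliqueᵇ G)
    {v = subset X} {xs = allSubsets (size G)}
    (∈-lookup {xs = bicliques G} X)))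

  split : ∀ {X u v x} → u ∈ X → v ∈ X → x ∈ X → Adj G u v →
    (Adj G u x × ¬ Adj G v x) ⊎ (¬ Adj G u x × Adj G v x)
  split {X} u∈ v∈ x∈ uv =
    let A , sides = completeBipartite-sides (subset X)
                      (proj₁ (∧-elim {IsCompleteBipartiteᵇ G (subset X)} (isBiclique X)))
    in split-sides {subset X} A sides (holds u∈) (holds v∈) (holds x∈) uv

  sharesEdge : KV → KV → V → V → Bool
  sharesEdge X Y u v = (u ∈ˢ S) ∧ (u ∈ˢ R) ∧ (v ∈ˢ S) ∧ (v ∈ˢ R) ∧ adj G u v
    where
    S R : Subset (size G)
    S = subset X
    R = subset Y

  shared-edge : ∀ {X Y} → Adj (KBe G) X Y →
    ∃ λ u → ∃ λ v → u ∈ X × u ∈ Y × v ∈ X × v ∈ Y × Adj G u v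
  shared-edge {X} {Y} h =
    let u , h₁   = any-elim (λ u → existsV (size G) (sharesEdge X Y u)) (allFin _)
                     (proj₂ (∧-elim {X ≠ᵇ Y} h))
        v , h₂   = any-elim (sharesEdge X Y u) (allFin _) h₁
        uX , h₃  = ∧-elim {u ∈ˢ subset X} h₂
        uY , h₄  = ∧-elim {u ∈ˢ subset Y} h₃
        vX , h₅  = ∧-elim {v ∈ˢ subset X} h₄
        vY , uv  = ∧-elim {v ∈ˢ subset Y} h₅
    in u , v , mem uX , mem uY , mem vX , mem vY , uv

  share⇒adj : ∀ {X Y u v} → X ≢ Y → u ∈ X → v ∈ X → u ∈ Y → v ∈ Y → Adj G u v →
    Adj (KBe G) X Y
  share⇒adj {X} {Y} {u} {v} X≢Y (mem uX) (mem vX) (mem uY) (mem vY) uv =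
    ∧-intro (≠ᵇ-intro X≢Y)
      (existsV-intro (λ u → existsV (size G) (sharesEdge X Y u)) u
        (existsV-intro (sharesEdge X Y u) v
          (∧-intro uX (∧-intro uY (∧-intro vX (∧-intro vY uv))))))

  KBe-irr : ∀ {X} → ¬ Adj (KBe G) X X
  KBe-irr {X} h = ≠ᵇ-elim {i = X} (proj₁ (∧-elim {X ≠ᵇ X} h)) refl

  KBe-sym : ∀ X Y → Adj (KBe G) X Y → Adj (KBe G) Y X
  KBe-sym X Y h =
    let u , v , uX , uY , vX , vY , uv = shared-edge {X} {Y} h
    in share⇒adj {Y} {X} (λ { refl → KBe-irr {X} h }) uY vY uX vX uv

  KBe-simple : IsSimple (KBe G)
  KBe-simple =
    (λ X Y → true-iff⇒≡ (KBe-sym X Y) (KBe-sym Y X)) , λ X → ¬-not (KBe-irr {X})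

-- The facts about bicliques that the proof needs; maximality enters only through path-extends.
record BicliqueGraph (G K : Graph) : Set₁ where
  infix 4 _∈_
  field
    _∈_          : Fin (size G) → Fin (size K) → Set
    G-simple     : IsSimple G
    K-simple     : IsSimple K
    -- Being complete bipartite, expressed without naming the two sides.
    split        : ∀ {X u v x} → u ∈ X → v ∈ X → x ∈ X → Adj G u v →
                   (Adj G u x × ¬ Adj G v x) ⊎ (¬ Adj G u x × Adj G v x)
    path-extends : ∀ {a b c} → Adj G a b → Adj G b c → ¬ Adj G a c →
                   ∃ λ X → a ∈ X × b ∈ X × c ∈ X
    shared-edge  : ∀ {X Y} → Adj K X Y →
                   ∃ λ u → ∃ λ v → u ∈ X × u ∈ Y × v ∈ X × v ∈ Y × Adj G u v
    share⇒adj    : ∀ {X Y u v} → X ≢ Y → u ∈ X → v ∈ X → u ∈ Y → v ∈ Y →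
                   Adj G u v → Adj K X Y

  symm : ∀ {u v} → Adj G u v → Adj G v u
  symm {u} {v} = trans (sym (proj₁ G-simple u v))

  K-irr : ∀ {X} → ¬ Adj K X X
  K-irr {X} h = case trans (sym h) (proj₂ K-simple X) of λ ()

  triangle-free : ∀ {X a b c} → a ∈ X → b ∈ X → c ∈ X →
    Adj G a b → Adj G b c → ¬ Adj G a c
  triangle-free a∈ b∈ c∈ ab bc ac with split a∈ b∈ c∈ ab
  ... | inj₁ (_ , ¬bc) = ¬bc bc
  ... | inj₂ (¬ac , _) = ¬ac ac

  -- Non-adjacent members `b`, `c` of a biclique lie on the same side, which faces `a`.
  opposite : ∀ {X a b c} → a ∈ X → b ∈ X → c ∈ X →
    Adj G a b → ¬ Adj G b c → Adj G a c
  opposite a∈ b∈ c∈ ab ¬bc with split a∈ b∈ c∈ ab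
  ... | inj₁ (ac , _) = ac
  ... | inj₂ (_ , bc) = contradiction bc ¬bc

KBe-bicliqueGraph : ∀ G → IsSimple G → BicliqueGraph G (KBe G)
KBe-bicliqueGraph G simple = record
  { _∈_          = B._∈_
  ; G-simple     = simple
  ; K-simple     = B.KBe-simple
  ; split        = B.split
  ; path-extends = B.path-∈-biclique
  ; shared-edge  = λ {X} {Y} → B.shared-edge {X} {Y}
  ; share⇒adj    = λ {X} {Y} → B.share⇒adj {X} {Y}
  }
  where module B = Bicliques G simple

-- Cyclic indices

toℕ-sucMod : ∀ {k} (i : Fin (suc k)) → toℕ (sucMod i) ≡ suc (toℕ i) % suc k
toℕ-sucMod {k} i = toℕ-fromℕ< (m%n<n (suc (toℕ i)) (suc k))

toℕ-predMod : ∀ {k} (i : Fin (suc k)) → toℕ (predMod i) ≡ (toℕ i + k) % suc k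
toℕ-predMod {k} i = toℕ-fromℕ< (m%n<n (toℕ i + k) (suc k))

%-+-idemˡ : ∀ a b k → (a % suc k + b) % suc k ≡ (a + b) % suc k
%-+-idemˡ a b k = begin
  (a % suc k + b) % suc k                     ≡⟨ %-distribˡ-+ (a % suc k) b (suc k) ⟩
  (a % suc k % suc k + b % suc k) % suc k     ≡⟨ cong (λ t → (t + b % suc k) % suc k) (m%n%n≡m%n a (suc k)) ⟩
  (a % suc k + b % suc k) % suc k             ≡⟨ %-distribˡ-+ a b (suc k) ⟨
  (a + b) % suc k                             ∎
  where open ≡-Reasoning

suc%-suc : ∀ a k → suc (a % suc k) % suc k ≡ suc a % suc k
suc%-suc a k = begin
  suc (a % suc k) % suc k   ≡⟨ cong (_% suc k) (+-comm 1 (a % suc k)) ⟩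
  (a % suc k + 1) % suc k   ≡⟨ %-+-idemˡ a 1 k ⟩
  (a + 1) % suc k           ≡⟨ cong (_% suc k) (+-comm a 1) ⟩
  suc a % suc k             ∎
  where open ≡-Reasoning

toℕ+n%n : ∀ {k} (i : Fin (suc k)) → (toℕ i + suc k) % suc k ≡ toℕ i
toℕ+n%n {k} i = trans ([m+n]%n≡m%n (toℕ i) (suc k)) (m<n⇒m%n≡m (toℕ<n i))

predMod-sucMod : ∀ {n} (i : Fin n) → predMod (sucMod i) ≡ i
predMod-sucMod {suc k} i = toℕ-injective (begin
  toℕ (predMod (sucMod i))               ≡⟨ toℕ-predMod (sucMod i) ⟩
  (toℕ (sucMod i) + k) % suc k           ≡⟨ cong (λ t → (t + k) % suc k) (toℕ-sucMod i) ⟩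
  (suc (toℕ i) % suc k + k) % suc k      ≡⟨ %-+-idemˡ (suc (toℕ i)) k k ⟩
  (suc (toℕ i) + k) % suc k              ≡⟨ cong (_% suc k) (+-suc (toℕ i) k) ⟨
  (toℕ i + suc k) % suc k                ≡⟨ toℕ+n%n i ⟩
  toℕ i                                  ∎)
  where open ≡-Reasoning

sucMod-predMod : ∀ {n} (i : Fin n) → sucMod (predMod i) ≡ i
sucMod-predMod {suc k} i = toℕ-injective (begin
  toℕ (sucMod (predMod i))               ≡⟨ toℕ-sucMod (predMod i) ⟩
  suc (toℕ (predMod i)) % suc k          ≡⟨ cong (λ t → suc t % suc k) (toℕ-predMod i) ⟩
  suc ((toℕ i + k) % suc k) % suc k      ≡⟨ suc%-suc (toℕ i + k) k ⟩
  suc (toℕ i + k) % suc k                ≡⟨ cong (_% suc k) (+-suc (toℕ i) k) ⟨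
  (toℕ i + suc k) % suc k                ≡⟨ toℕ+n%n i ⟩
  toℕ i                                  ∎)
  where open ≡-Reasoning

sucMod-injective : ∀ {n} {i j : Fin n} → sucMod i ≡ sucMod j → i ≡ j
sucMod-injective {i = i} {j} eq =
  trans (sym (predMod-sucMod i)) (trans (cong predMod eq) (predMod-sucMod j))

sucModⁿ : ∀ {n} → ℕ → Fin n → Fin n
sucModⁿ zero    i = i
sucModⁿ (suc j) i = sucMod (sucModⁿ j i)

toℕ-sucModⁿ : ∀ {k} j (i : Fin (suc k)) → toℕ (sucModⁿ j i) ≡ (j + toℕ i) % suc k
toℕ-sucModⁿ zero        i = sym (m<n⇒m%n≡m (toℕ<n i))
toℕ-sucModⁿ {k} (suc j) i = begin
  toℕ (sucMod (sucModⁿ j i))           ≡⟨ toℕ-sucMod (sucModⁿ j i) ⟩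
  suc (toℕ (sucModⁿ j i)) % suc k      ≡⟨ cong (λ t → suc t % suc k) (toℕ-sucModⁿ j i) ⟩
  suc ((j + toℕ i) % suc k) % suc k    ≡⟨ suc%-suc (j + toℕ i) k ⟩
  suc (j + toℕ i) % suc k              ∎
  where open ≡-Reasoning

-- A shift that returned to `i` would make `n` divide the positive number `suc j`, which is smaller
-- than `n`.
sucModⁿ≢id : ∀ {n} j (i : Fin n) → suc j < n → sucModⁿ (suc j) i ≢ i
sucModⁿ≢id {suc k} j i j<n eq = <⇒≱ j<n (∣⇒≤ (divides q sj≡qn))
  where
  open ≡-Reasoning
  q : ℕ
  q = (suc j + toℕ i) / suc k
  sj≡qn : suc j ≡ q * suc k
  sj≡qn = +-cancelˡ-≡ (toℕ i) (suc j) (q * suc k) (begin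
    toℕ i + suc j                              ≡⟨ +-comm (toℕ i) (suc j) ⟩
    suc j + toℕ i                              ≡⟨ m≡m%n+[m/n]*n (suc j + toℕ i) (suc k) ⟩
    (suc j + toℕ i) % suc k + q * suc k        ≡⟨ cong (_+ q * suc k) (toℕ-sucModⁿ (suc j) i) ⟨
    toℕ (sucModⁿ (suc j) i) + q * suc k        ≡⟨ cong (λ t → toℕ t + q * suc k) eq ⟩
    toℕ i + q * suc k                          ∎)

-- The bound on the cycle length enters the proof through these four inequalities; the last one uses
-- its full strength.
module ShortShifts {n : ℕ} (n≥5 : n ≥ 5) where

  s¹≢ : ∀ {i} → sucModⁿ 1 i ≢ i
  s¹≢ {i} = sucModⁿ≢id 0 i (<-≤-trans (s≤s (s≤s z≤n)) n≥5)

  s²≢ : ∀ {i} → sucModⁿ 2 i ≢ i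
  s²≢ {i} = sucModⁿ≢id 1 i (<-≤-trans (s≤s (s≤s (s≤s z≤n))) n≥5)

  s³≢ : ∀ {i} → sucModⁿ 3 i ≢ i
  s³≢ {i} = sucModⁿ≢id 2 i (<-≤-trans (s≤s (s≤s (s≤s (s≤s z≤n)))) n≥5)

  s⁴≢ : ∀ {i} → sucModⁿ 4 i ≢ i
  s⁴≢ {i} = sucModⁿ≢id 3 i n≥5

-- Cycles with good neighbors, and vertices attached to one edge

record GoodCycle (G : Graph) {n : ℕ} (c : Fin n → Fin (size G)) : Set where
  field
    injective : ∀ {i j} → c i ≡ c j → i ≡ j
    step      : ∀ i → Adj G (c i) (c (sucMod i))
    adj⇒cyc   : ∀ {i j} → Adj G (c i) (c j) → CycAdj i j
    -- Centred at `sucMod i`, so that only successors occur. The first alternative lets `v` be on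
    -- the cycle.
    good      : ∀ {v} i → Adj G v (c i) → Adj G v (c (sucMod (sucMod i))) →
                v ≡ c (sucMod i) ⊎ Adj G v (c (sucMod i))

-- How a single clique vertex of a necklace is attached to the cycle. Adjacency between such
-- vertices is treated separately.
record Pendant (G : Graph) {n : ℕ} (c : Fin n → Fin (size G))
  (w : Fin (size G)) (i : Fin n) : Set where
  field
    left  : Adj G w (c i)
    right : Adj G w (c (sucMod i))
    only  : ∀ {j} → Adj G w (c j) → j ≡ i ⊎ j ≡ sucMod i

-- Lifting a good cycle to the biclique graph

module Lift {G K : Graph} (BG : BicliqueGraph G K) {n : ℕ} (n≥5 : n ≥ 5)
  {c : Fin n → Fin (size G)} (C : GoodCycle G c) where
  open BicliqueGraph BG
  open GoodCycle C
  open ShortShifts n≥5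

  private
    s : Fin n → Fin n
    s = sucMod

  dist2-nonadj : ∀ {i} → ¬ Adj G (c i) (c (s (s i)))
  dist2-nonadj h with adj⇒cyc h
  ... | inj₁ eq = s¹≢ eq
  ... | inj₂ eq = s³≢ (sym eq)

  dist3-nonadj : ∀ {i} → ¬ Adj G (c i) (c (s (s (s i))))
  dist3-nonadj h with adj⇒cyc h
  ... | inj₁ eq = s²≢ (sucMod-injective eq)
  ... | inj₂ eq = s⁴≢ (sym eq)

  private
    star : ∀ i → ∃ λ X → c (predMod i) ∈ X × c i ∈ X × c (s i) ∈ X
    star i = path-extends before (step i) apart
      where
      before : Adj G (c (predMod i)) (c i)
      before = subst (λ j → Adj G (c (predMod i)) (c j)) (sucMod-predMod i) (step (predMod i))
      apart : ¬ Adj G (c (predMod i)) (c (s i))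
      apart = subst (λ j → ¬ Adj G (c (predMod i)) (c (s j))) (sucMod-predMod i) dist2-nonadj

  B : Fin n → Fin (size K)
  B i = proj₁ (star i)

  ∋center : ∀ {i} → c i ∈ B i
  ∋center {i} = proj₁ (proj₂ (proj₂ (star i)))

  ∋next : ∀ {i} → c (s i) ∈ B i
  ∋next {i} = proj₂ (proj₂ (proj₂ (star i)))

  ∋previous : ∀ {i} → c i ∈ B (s i)
  ∋previous {i} =
    subst (λ j → c j ∈ B (s i)) (predMod-sucMod i) (proj₁ (proj₂ (star (s i))))

  -- A vertex `v` adjacent to the centre lies on the side of `c i` and `c (s (s i))`, so `u` is
  -- adjacent to both. By good neighbors `u` is the centre or adjacent to it; the latter closes a
  -- triangle with `v`.
  neighbour-of-leaf : ∀ {i u v} → u ∈ B (s i) → v ∈ B (s i) → Adj G u v →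
    Adj G v (c (s i)) → u ≡ c (s i)
  neighbour-of-leaf {i} u∈ v∈ uv vc
    with good i
           (opposite u∈ v∈ ∋previous uv (triangle-free v∈ ∋center ∋previous vc (symm (step i))))
           (opposite u∈ v∈ ∋next uv (triangle-free v∈ ∋center ∋next vc (step (s i))))
  ... | inj₁ u≡c = u≡c
  ... | inj₂ uc  = contradiction uc (triangle-free u∈ v∈ ∋center uv vc)

  private
    -- One end of the edge is adjacent to the centre, and then the other end is the centre: the
    -- biclique is a star.
    edge-at-center′ : ∀ {i u v} → u ∈ B (s i) → v ∈ B (s i) → Adj G u v →
      u ≡ c (s i) ⊎ v ≡ c (s i)
    edge-at-center′ u∈ v∈ uv with split u∈ v∈ ∋center uv
    ... | inj₁ (uc , _) = inj₂ (neighbour-of-leaf v∈ u∈ (symm uv) uc)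
    ... | inj₂ (_ , vc) = inj₁ (neighbour-of-leaf u∈ v∈ uv vc)

  edge-at-center : ∀ {i u v} → u ∈ B i → v ∈ B i → Adj G u v → u ≡ c i ⊎ v ≡ c i
  edge-at-center {i} {u} {v} = subst
    (λ j → u ∈ B j → v ∈ B j → Adj G u v → u ≡ c j ⊎ v ≡ c j) (sucMod-predMod i) edge-at-center′

  -- The shared edge is an edge of the star, so it passes through the centre `c i`.
  adj-B⇒edge : ∀ {X i} → Adj K X (B i) →
    c i ∈ X × ∃ λ x → x ∈ X × x ∈ B i × Adj G (c i) x
  adj-B⇒edge h with shared-edge h
  ... | u , v , uX , uB , vX , vB , uv with edge-at-center uB vB uv
  ...   | inj₁ refl = uX , v , vX , vB , uv
  ...   | inj₂ refl = vX , u , uX , uB , symm uv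

  -- `B (s j)` contains two consecutive cycle edges. If it is also the star at `c i`, both edges
  -- pass through `c i`, which must be their common vertex `c (s j)`.
  B-injective : ∀ {i j} → B i ≡ B j → i ≡ j
  B-injective {i} {j} eq =
    subst (λ j → B i ≡ B j → i ≡ j) (sucMod-predMod j) inj eq
    where
    inj : ∀ {j} → B i ≡ B (s j) → i ≡ s j
    inj {j} eq
      with edge-at-center (subst (c j ∈_) (sym eq) ∋previous)
             (subst (c (s j) ∈_) (sym eq) ∋center) (step j)
         | edge-at-center (subst (c (s j) ∈_) (sym eq) ∋center)
             (subst (c (s (s j)) ∈_) (sym eq) ∋next) (step (s j))
    ... | inj₂ p | _      = injective (sym p)
    ... | inj₁ p | inj₁ q = injective (sym q)
    ... | inj₁ p | inj₂ q = contradiction (injective (trans q (sym p))) s²≢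

  goodCycle : GoodCycle K B
  goodCycle = record
    { injective = B-injective
    ; step      = λ i → share⇒adj (λ eq → s¹≢ (sym (B-injective eq)))
                    ∋center ∋next ∋previous ∋center (step i)
    ; adj⇒cyc   = cyc′
    ; good      = good′
    }
    where
    -- A shared edge has both centres among its ends; as these differ, the edge joins `c i` to
    -- `c j`.
    cyc′ : ∀ {i j} → Adj K (B i) (B j) → CycAdj i j
    cyc′ {i} {j} h with shared-edge h
    ... | u , v , uBi , uBj , vBi , vBj , uv
      with edge-at-center uBi vBi uv | edge-at-center uBj vBj uv
    ... | inj₁ p | inj₂ q rewrite p | q = adj⇒cyc uv
    ... | inj₂ p | inj₁ q rewrite p | q = adj⇒cyc (symm uv)
    ... | inj₁ p | inj₁ q = ⊥-elim (K-irr
            (subst (λ k → Adj K (B i) (B k)) (sym (injective (trans (sym p) q))) h))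
    ... | inj₂ p | inj₂ q = ⊥-elim (K-irr
            (subst (λ k → Adj K (B i) (B k)) (sym (injective (trans (sym p) q))) h))

    -- `X` shares an edge from `c i` to some `x` with `B i`, and has `c (s (s i))` on the side of
    -- `c i`, so `x` is adjacent to both. By good neighbors `x` is `c (s i)`, and the edge lies in
    -- `B (s i)` as well, or `B i` contains a triangle.
    good′ : ∀ {X} i → Adj K X (B i) → Adj K X (B (s (s i))) →
      X ≡ B (s i) ⊎ Adj K X (B (s i))
    good′ {X} i h₁ h₂ with X ≟ B (s i) | adj-B⇒edge h₁ | adj-B⇒edge h₂
    ... | yes eq | _ | _ = inj₁ eq
    ... | no X≢B | c∈X , x , x∈X , x∈B , cx | c″∈X , _
      with good i (symm cx) (opposite x∈X c∈X c″∈X (symm cx) dist2-nonadj)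
    ... | inj₁ refl = inj₂ (share⇒adj X≢B c∈X x∈X ∋previous ∋center cx)
    ... | inj₂ xc′  = contradiction (step i) (triangle-free ∋center x∈B ∋next cx xc′)

  -- Bicliques attached to one edge of the lifted cycle

  near : ∀ {X i j} → c i ∈ X → c (s i) ∈ X → c j ∈ X → CycAdj i j ⊎ CycAdj (s i) j
  near {i = i} i∈ si∈ j∈ with split i∈ si∈ j∈ (step i)
  ... | inj₁ (h , _) = inj₁ (adj⇒cyc h)
  ... | inj₂ (_ , h) = inj₂ (adj⇒cyc h)

  -- Adjacency to `B j` forces `c j` into `X`, so `only` bounds the neighbors of `X`. Both `B i` and
  -- `B (s i)` contain a third cycle vertex and hence differ from `X`.
  pendant : ∀ {X i} → c i ∈ X → c (s i) ∈ X → (∀ {j} → c j ∈ X → j ≡ i ⊎ j ≡ s i) →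
    Pendant K B X i
  pendant {X} {i} i∈ si∈ only = record
    { left  = share⇒adj X≢Bi i∈ si∈ ∋center ∋next (step i)
    ; right = share⇒adj X≢Bsi i∈ si∈ ∋previous ∋center (step i)
    ; only  = λ h → only (proj₁ (adj-B⇒edge h))
    }
    where
    X≢Bsi : X ≢ B (s i)
    X≢Bsi refl with only ∋next
    ... | inj₁ eq = s²≢ eq
    ... | inj₂ eq = s¹≢ eq

    X≢Bi : X ≢ B i
    X≢Bi refl with only (subst (λ j → c (predMod i) ∈ B j) (sucMod-predMod i) ∋previous)
    ... | inj₁ eq = s¹≢ (trans (sucMod-predMod i) (sym eq))
    ... | inj₂ eq = s²≢ (trans (cong s (sucMod-predMod i)) (sym eq))

  module _ {w i} (P : Pendant G c w (s i)) where
    open Pendant P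

    w≁before : ¬ Adj G w (c i)
    w≁before h with only h
    ... | inj₁ eq = s¹≢ (sym eq)
    ... | inj₂ eq = s²≢ (sym eq)

    before-biclique : ∃ λ X → c i ∈ X × c (s i) ∈ X × w ∈ X
    before-biclique = path-extends (step i) (symm left) (w≁before ∘ symm)

    -- By `near`, the only other candidates are the cycle vertices just before `c i` and just after
    -- `c (s i)`. The second closes a triangle with `w` and `c (s i)`. The first faces `c i`, hence
    -- also `w`, contradicting `only`.
    before-pendant : ∀ {X} → c i ∈ X → c (s i) ∈ X → w ∈ X → Pendant K B X i
    before-pendant {X} i∈ si∈ w∈ = pendant i∈ si∈ only′
      where
      only′ : ∀ {j} → c j ∈ X → j ≡ i ⊎ j ≡ s i
      only′ {j} j∈ with near i∈ si∈ j∈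
      ... | inj₁ (inj₁ j≡si)  = inj₂ j≡si
      ... | inj₂ (inj₂ si≡sj) = inj₁ (sym (sucMod-injective si≡sj))
      ... | inj₂ (inj₁ refl)  = contradiction right
              (triangle-free w∈ si∈ j∈ left (step (s i)))
      ... | inj₁ (inj₂ refl)
        with only (symm (opposite j∈ i∈ w∈ (step j) (w≁before ∘ symm)))
      ...   | inj₁ eq = contradiction (sym eq) s²≢
      ...   | inj₂ eq = contradiction (sym eq) s³≢

  module _ {w i} (P : Pendant G c w i) where
    open Pendant P

    w≁after : ¬ Adj G w (c (s (s i)))
    w≁after h with only h
    ... | inj₁ eq = s²≢ eq
    ... | inj₂ eq = s¹≢ eq

    after-biclique : ∃ λ X → w ∈ X × c (s i) ∈ X × c (s (s i)) ∈ X
    after-biclique = path-extends right (step (s i)) w≁after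

    -- Mirror image of `before-pendant`: now `c i` closes the triangle, and the vertex after
    -- `c (s (s i))` would be adjacent to `w`.
    after-pendant : ∀ {X} → w ∈ X → c (s i) ∈ X → c (s (s i)) ∈ X → Pendant K B X (s i)
    after-pendant {X} w∈ si∈ ssi∈ = pendant si∈ ssi∈ only′
      where
      only′ : ∀ {j} → c j ∈ X → j ≡ s i ⊎ j ≡ s (s i)
      only′ {j} j∈ with near si∈ ssi∈ j∈
      ... | inj₁ (inj₁ j≡ssi) = inj₂ j≡ssi
      ... | inj₂ (inj₂ eq)    = inj₁ (sym (sucMod-injective eq))
      ... | inj₁ (inj₂ eq)    = contradiction right
              (triangle-free w∈ j∈ si∈ (subst (λ k → Adj G w (c k)) i≡j left)
                (subst (λ k → Adj G (c j) (c k)) (sym eq) (step j)))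
              where
              i≡j : i ≡ j
              i≡j = sucMod-injective eq
      ... | inj₂ (inj₁ refl)
        with only (symm (opposite j∈ ssi∈ w∈ (symm (step (s (s i)))) (w≁after ∘ symm)))
      ...   | inj₁ eq = contradiction eq s³≢
      ...   | inj₂ eq = contradiction (sucMod-injective eq) s²≢

  -- Equality would place the triangle `w`, `w′`, `z` in one biclique.
  distinct : ∀ {X Y w w′ z} → Adj G w w′ → Adj G w z → Adj G w′ z →
    w ∈ X → z ∈ X → w′ ∈ Y → X ≢ Y
  distinct ww′ wz w′z w∈ z∈ w′∈ refl = triangle-free w∈ w′∈ z∈ ww′ w′z wz

  -- Separating the bicliques on the two sides of an edge

  private
    -- In `S`, `p` is on the side of `c (s i)` and `q` on that of `c (s (s i))`. In `Y`, the
    -- non-adjacent `c i` and `c (s (s (s i)))` share a side, facing `p` or `q`. Good neighbors then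
    -- makes the facing vertex a cycle vertex at distance 2 from one of that pair, or gives it an
    -- adjacency that is excluded in `S`.
    no-crossing-edge : ∀ {S Y i p q} → c (s i) ∈ S → c (s (s i)) ∈ S →
      c i ∈ Y → c (s (s (s i))) ∈ Y → p ∈ Y → p ∈ S → q ∈ Y → q ∈ S → Adj G p q →
      Adj G p (c (s (s i))) → ¬ Adj G q (c (s (s i))) → ⊥
    no-crossing-edge {i = i} {p} {q} s∈S ss∈S i∈Y sss∈Y p∈Y p∈S q∈Y q∈S pq p~ss q≁ss
      with split p∈Y q∈Y i∈Y pq
    ... | inj₁ (p~i , _) = case good i p~i p~ss of λ
      { (inj₁ refl) → dist2-nonadj (opposite p∈Y i∈Y sss∈Y p~i dist3-nonadj)
      ; (inj₂ p~s)  → p≁s p~s }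
      where
      p≁s : ¬ Adj G p (c (s i))
      p≁s = triangle-free p∈S ss∈S s∈S p~ss (symm (step (s i)))
    ... | inj₂ (_ , q~i) =
      case good (s i) (opposite q∈S p∈S s∈S (symm pq) p≁s)
                      (opposite q∈Y i∈Y sss∈Y q~i dist3-nonadj) of λ
      { (inj₁ refl) → dist2-nonadj (symm q~i)
      ; (inj₂ q~ss) → q≁ss q~ss }
      where
      p≁s : ¬ Adj G p (c (s i))
      p≁s = triangle-free p∈S ss∈S s∈S p~ss (symm (step (s i)))

  -- Supplies the hypothesis `no-common` of `before-after-nonadj` one level up, with `S` as the
  -- clique vertex `w`.
  no-common-neighbour : ∀ {S Y i} → c (s i) ∈ S → c (s (s i)) ∈ S →
    Adj K Y (B i) → Adj K Y (B (s (s (s i)))) → ¬ Adj K Y S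
  no-common-neighbour s∈S ss∈S Y~Bi Y~Bsss Y~S
    with shared-edge Y~S | adj-B⇒edge Y~Bi | adj-B⇒edge Y~Bsss
  ... | p , q , p∈Y , p∈S , q∈Y , q∈S , pq | i∈Y , _ | sss∈Y , _
    with split p∈S q∈S ss∈S pq
  ... | inj₁ (p~ , q≁) = no-crossing-edge s∈S ss∈S i∈Y sss∈Y p∈Y p∈S q∈Y q∈S pq p~ q≁
  ... | inj₂ (p≁ , q~) = no-crossing-edge s∈S ss∈S i∈Y sss∈Y q∈Y q∈S p∈Y p∈S (symm pq) q~ p≁

  module _ {w w′ i E D}
    (no-common : ∀ {y} → Adj G y (c i) → Adj G y (c (s (s (s i)))) → ¬ Adj G y w)
    (P : Pendant G c w (s i)) (P′ : Pendant G c w′ (s i))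
    (i∈E : c i ∈ E) (s∈E : c (s i) ∈ E) (w∈E : w ∈ E)
    (w′∈D : w′ ∈ D) (ss∈D : c (s (s i)) ∈ D) (sss∈D : c (s (s (s i))) ∈ D)
    where

    private
      no-shared : ∀ {x y} → x ∈ E → x ∈ D → y ∈ E → y ∈ D → Adj G x y →
        Adj G x (c (s i)) → ¬ Adj G y (c (s i)) → ⊥
      no-shared {x} {y} x∈E x∈D y∈E y∈D xy x~s y≁s with split x∈D y∈D sss∈D xy
      ... | inj₂ (_ , y~sss) = no-common y~i y~sss y~w
        where
        y~i : Adj G y (c i)
        y~i = opposite y∈E x∈E i∈E (symm xy)
          (triangle-free x∈E s∈E i∈E x~s (symm (step i)))
        y~w : Adj G y w
        y~w = opposite y∈E x∈E w∈E (symm xy)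
          (triangle-free x∈E s∈E w∈E x~s (symm (Pendant.left P)))
      -- Good neighbors, applied twice, forces `x` to be `c (s (s i))` and then `y` to be `c (s i)`;
      -- with `w′` they form a triangle in `D`.
      ... | inj₁ (x~sss , _) with good (s i) x~s x~sss
      ...   | inj₂ x~ss = triangle-free x∈D ss∈D sss∈D x~ss (step (s (s i))) x~sss
      ...   | inj₁ refl with good i y~i (symm xy)
        where
        y~i : Adj G y (c i)
        y~i = opposite y∈E x∈E i∈E (symm xy)
          (triangle-free x∈E s∈E i∈E x~s (symm (step i)))
      ...     | inj₂ y~s = y≁s y~s
      ...     | inj₁ refl =
        triangle-free w′∈D y∈D ss∈D (Pendant.left P′) (step (s i)) (Pendant.right P′)

    before-after-nonadj : ¬ Adj K E D
    before-after-nonadj h with shared-edge h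
    ... | x , y , x∈E , x∈D , y∈E , y∈D , xy with split x∈E y∈E s∈E xy
    ...   | inj₁ (x~ , y≁) = no-shared x∈E x∈D y∈E y∈D xy x~ y≁
    ...   | inj₂ (x≁ , y~) = no-shared y∈E y∈D x∈E x∈D (symm xy) y~ x≁

  -- In a common biclique `w` would face `c (s i)`, hence also `w′`, which is not adjacent to
  -- `c (s i)`.
  after≢before : ∀ {w w′ i X Y} → Pendant G c w i → Pendant G c w′ (s (s i)) →
    ¬ Adj G w w′ → w ∈ X → c (s i) ∈ X → w′ ∈ Y → X ≢ Y
  after≢before P P′ w≁w′ w∈ s∈ w′∈ refl =
    w≁w′ (opposite w∈ s∈ w′∈ (Pendant.right P) (w≁before P′ ∘ symm))

-- Passing between necklaces and good cycles

necklace⇒goodCycle : ∀ {G n m} → n ≥ 5 → ((N , _) : HasGoodNecklace G n m) → GoodCycle G (cyc N)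
necklace⇒goodCycle {G} {n} n≥5 (N , gn) = record
  { injective = cyc-inj N _ _
  ; step      = λ i → cyc-adj⁻ N i (sucMod i) (inj₁ refl)
  ; adj⇒cyc   = cyc-adj N _ _
  ; good      = good
  }
  where
  open ShortShifts n≥5
  c : Fin n → Fin (size G)
  c = cyc N

  good : ∀ {v} i → Adj G v (c i) → Adj G v (c (sucMod (sucMod i))) →
    v ≡ c (sucMod i) ⊎ Adj G v (c (sucMod i))
  good {v} i vi vssi with any? (λ k → v ≟ c k)
  ... | no v∉c = inj₂ (gn v (λ k eq → v∉c (k , eq)) (sucMod i)
          (subst (λ k → Adj G v (c k)) (sym (predMod-sucMod i)) vi) vssi)
  ... | yes (k , refl) with cyc-adj N k i vi | cyc-adj N k (sucMod (sucMod i)) vssi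
  ...   | inj₂ refl | _         = inj₁ refl
  ...   | inj₁ _    | inj₁ eq   = inj₁ (cong c (sym (sucMod-injective eq)))
  -- Here `c k` both precedes `c i` and follows `c (s (s i))` in cyclic order, so four steps would
  -- return to `k`.
  ...   | inj₁ refl | inj₂ eq   = contradiction (sym eq) s⁴≢

-- Clique vertices are distinct because adjacency is irreflexive, and lie off the cycle because no
-- cycle vertex is adjacent to both ends of a cycle edge.
pendants⇒necklace : ∀ {G n m c} → IsSimple G → n ≥ 5 → GoodCycle G {n} c →
  (w : Fin m → Fin (size G)) (i : Fin n) → (∀ a → Pendant G c (w a) i) →
  (∀ a b → a ≢ b → Adj G (w a) (w b)) → HasGoodNecklace G n m
pendants⇒necklace {G} {n} {m} {c} (comm , irr) n≥5 C w i P clique = record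
  { cyc      = c
  ; cl       = w
  ; e        = i
  ; cyc-inj  = λ _ _ → injective
  ; cl-inj   = cl-injective
  ; cyc≢cl   = disjoint
  ; cyc-adj  = λ _ _ → adj⇒cyc
  ; cyc-adj⁻ = λ { j _ (inj₁ refl) → step j ; _ k (inj₂ refl) → symm (step k) }
  ; cl-adj   = clique
  ; cl-cyc   = λ a _ → only (P a)
  ; cl-cyc⁻  = λ { a _ (inj₁ refl) → left (P a) ; a _ (inj₂ refl) → right (P a) }
  } , good-neighbors
  where
  open GoodCycle C
  open Pendant
  open ShortShifts n≥5

  symm : ∀ {u v} → Adj G u v → Adj G v u
  symm {u} {v} = trans (sym (comm u v))

  cl-injective : ∀ a b → w a ≡ w b → a ≡ b
  cl-injective a b eq with a ≟ b
  ... | yes a≡b = a≡b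
  ... | no a≢b  = case trans (sym (clique a b a≢b))
                    (trans (cong (adj G (w a)) (sym eq)) (irr (w a))) of λ ()

  disjoint : ∀ j a → ¬ (c j ≡ w a)
  disjoint j a eq
    with adj⇒cyc (subst (λ v → Adj G v (c i)) (sym eq) (left (P a)))
       | adj⇒cyc (subst (λ v → Adj G v (c (sucMod i))) (sym eq) (right (P a)))
  ... | inj₁ i≡sj | inj₁ si≡sj = s¹≢ (trans si≡sj (sym i≡sj))
  ... | inj₁ refl | inj₂ j≡ssi = s³≢ (sym j≡ssi)
  ... | inj₂ refl | inj₁ si≡sj = s¹≢ (sym si≡sj)
  ... | inj₂ refl | inj₂ j≡ssi = s¹≢ (sym j≡ssi)

  good-neighbors : GoodNeighbors G c
  good-neighbors v v∉c j vp vs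
    with good (predMod j) vp
           (subst (λ k → Adj G v (c (sucMod k))) (sym (sucMod-predMod j)) vs)
  ... | inj₁ eq = contradiction eq (v∉c (sucMod (predMod j)))
  ... | inj₂ h  = subst (λ k → Adj G v (c k)) (sucMod-predMod j) h

-- Three applications of the biclique graph

KBe³-necklace : ∀ {G₀ G₁ G₂ G₃} → BicliqueGraph G₀ G₁ → BicliqueGraph G₁ G₂ →
  BicliqueGraph G₂ G₃ → ∀ {n m} → n ≥ 5 → HasGoodNecklace G₀ n (suc m) →
  HasGoodNecklace G₃ n (suc (suc m))
KBe³-necklace {G₀} {G₁} {G₂} {G₃} BG₁ BG₂ BG₃ {n} {m} n≥5 (N , gn) =
  pendants⇒necklace (BicliqueGraph.K-simple BG₃) n≥5 L₃.goodCycle family (s i) pendants clique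
  where
  module L₁ = Lift BG₁ n≥5 (necklace⇒goodCycle n≥5 (N , gn))
  module L₂ = Lift BG₂ n≥5 L₁.goodCycle
  module L₃ = Lift BG₃ n≥5 L₂.goodCycle

  s : Fin n → Fin n
  s = sucMod

  i : Fin n
  -- Two steps back, so that all indices are successors of `i`: the original edge is at `s (s i)`,
  -- `S` at `s i`, `E` at `i`, `D` at `s (s i)`, and `family` at `s i`.
  i = predMod (predMod (e N))

  ssi≡e : s (s i) ≡ e N
  ssi≡e = trans (cong s (sucMod-predMod (predMod (e N)))) (sucMod-predMod (e N))

  w-pendant : ∀ a → Pendant G₀ (cyc N) (cl N a) (s (s i))
  w-pendant a = subst (Pendant G₀ (cyc N) (cl N a)) (sym ssi≡e) (record
    { left  = cl-cyc⁻ N a (e N) (inj₁ refl)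
    ; right = cl-cyc⁻ N a (s (e N)) (inj₂ refl)
    ; only  = cl-cyc N a _
    })

  S : Fin (suc m) → Fin (size G₁)
  S a = proj₁ (L₁.before-biclique (w-pendant a))

  S-pendant : ∀ a → Pendant G₁ L₁.B (S a) (s i)
  S-pendant a =
    let _ , p , q , r = L₁.before-biclique (w-pendant a) in L₁.before-pendant (w-pendant a) p q r

  S-adj : ∀ {a b} → a ≢ b → Adj G₁ (S a) (S b)
  S-adj {a} {b} a≢b =
    let _ , p , q , r    = L₁.before-biclique (w-pendant a)
        _ , p′ , q′ , r′ = L₁.before-biclique (w-pendant b)
    in BicliqueGraph.share⇒adj BG₁
         (L₁.distinct (cl-adj N a b a≢b) (Pendant.left (w-pendant a))
           (Pendant.left (w-pendant b)) r q r′)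
         p q p′ q′ (cyc-adj⁻ N (s i) (s (s i)) (inj₁ refl))

  D : Fin (suc m) → Fin (size G₂)
  D a = proj₁ (L₂.after-biclique (S-pendant a))

  D-pendant : ∀ a → Pendant G₂ L₂.B (D a) (s (s i))
  D-pendant a =
    let _ , p , q , r = L₂.after-biclique (S-pendant a) in L₂.after-pendant (S-pendant a) p q r

  D-adj : ∀ {a b} → a ≢ b → Adj G₂ (D a) (D b)
  D-adj {a} {b} a≢b =
    let _ , p , q , r    = L₂.after-biclique (S-pendant a)
        _ , p′ , q′ , r′ = L₂.after-biclique (S-pendant b)
    in BicliqueGraph.share⇒adj BG₂
         (L₂.distinct (S-adj a≢b) (Pendant.right (S-pendant a))
           (Pendant.right (S-pendant b)) p q p′)
         q r q′ r′ (GoodCycle.step L₁.goodCycle (s (s i)))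

  -- The one extra clique member; it is built from `S zero`, which exists since the clique is
  -- nonempty.
  E : Fin (size G₂)
  E = proj₁ (L₂.before-biclique (S-pendant zero))

  E-pendant : Pendant G₂ L₂.B E i
  E-pendant =
    let _ , p , q , r = L₂.before-biclique (S-pendant zero)
    in L₂.before-pendant (S-pendant zero) p q r

  E-D-nonadj : ∀ a → ¬ Adj G₂ E (D a)
  E-D-nonadj a =
    let _ , p , q , r    = L₂.before-biclique (S-pendant zero)
        _ , p′ , q′ , r′ = L₂.after-biclique (S-pendant a)
        _ , si∈S , ssi∈S , _ = L₁.before-biclique (w-pendant zero)
    in L₂.before-after-nonadj
         (λ h₁ h₂ → L₁.no-common-neighbour si∈S ssi∈S h₁ h₂)
         (S-pendant zero) (S-pendant a) p q r p′ q′ r′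

  -- Moving `E` one edge forward and each `D a` one edge back attaches them all to the edge at
  -- `s i`.
  family : Fin (suc (suc m)) → Fin (size G₃)
  family zero    = proj₁ (L₃.after-biclique E-pendant)
  family (suc a) = proj₁ (L₃.before-biclique (D-pendant a))

  pendants : ∀ a → Pendant G₃ L₃.B (family a) (s i)
  pendants zero =
    let _ , p , q , r = L₃.after-biclique E-pendant in L₃.after-pendant E-pendant p q r
  pendants (suc a) =
    let _ , p , q , r = L₃.before-biclique (D-pendant a) in L₃.before-pendant (D-pendant a) p q r

  open BicliqueGraph BG₃ using (_∈_; share⇒adj)

  contains-edge : ∀ a → L₂.B (s i) ∈ family a × L₂.B (s (s i)) ∈ family a
  contains-edge zero    = let _ , _ , q , r = L₃.after-biclique E-pendant in q , r
  contains-edge (suc a) = let _ , p , q , _ = L₃.before-biclique (D-pendant a) in p , q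

  E-D-distinct : ∀ a → family zero ≢ family (suc a)
  E-D-distinct a =
    let _ , p , q , _ = L₃.after-biclique E-pendant
        _ , _ , _ , r = L₃.before-biclique (D-pendant a)
    in L₃.after≢before E-pendant (D-pendant a) (E-D-nonadj a) p q r

  distinct : ∀ a b → a ≢ b → family a ≢ family b
  distinct zero    zero    a≢b = contradiction refl a≢b
  distinct zero    (suc b) _   = E-D-distinct b
  distinct (suc a) zero    _   = E-D-distinct a ∘ sym
  distinct (suc a) (suc b) a≢b =
    let _ , _ , q , r  = L₃.before-biclique (D-pendant a)
        _ , _ , _ , r′ = L₃.before-biclique (D-pendant b)
    in L₃.distinct (D-adj (a≢b ∘ cong suc)) (Pendant.left (D-pendant a))
         (Pendant.left (D-pendant b)) r q r′

  clique : ∀ a b → a ≢ b → Adj G₃ (family a) (family b)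
  clique a b a≢b =
    let p , q   = contains-edge a
        p′ , q′ = contains-edge b
    in share⇒adj (distinct a b a≢b) p q p′ q′ (GoodCycle.step L₂.goodCycle (s i))

theorem3 : (G : Graph) → IsSimple G → (n m : ℕ) → n ≥ 5 → m ≥ 1 →
    HasGoodNecklace G n m →
    (∃[ m' ] (m < m' × HasGoodNecklace (KBe^ 2 G) n m'))
    ⊎ (∃[ m' ] (m < m' × HasGoodNecklace (KBe^ 3 G) n m'))
theorem3 G simple n (suc m) n≥5 _ necklace =
  -- Three iterations work in every case, and the clique gains exactly one vertex.
  inj₂ (suc (suc m) , ≤-refl , KBe³-necklace BG₁ BG₂ BG₃ n≥5 necklace)
  where
  BG₁ = KBe-bicliqueGraph G simple
  BG₂ = KBe-bicliqueGraph (KBe G) (BicliqueGraph.K-simple BG₁)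
  BG₃ = KBe-bicliqueGraph (KBe (KBe G)) (BicliqueGraph.K-simple BG₂)
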